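{- Let $k$ be a positive integer. Every graph $G$ of clique-width $k$ has fusion-width at most $k$. Furthermore, for a $k$-expression generating $G$ there is an associated $k$-fusion-tree expression generating $G$ whose number of operations is not larger than the number of operations of the $k$-expression.
   Context: Graphs are finite, simple, undirected and nonempty. A $k$-labeled graph is a graph in which every vertex carries a label from $\{1,\dots,k\}$. A $k$-expression is an expression built from atoms $i(v)$, unary operations $\eta_{i,j}$ and $\rho_{i\to j}$, and the binary operation $\oplus$, with labels $i,j\in\{1,\dots,k\}$, where: $i(v)$ creates a single vertex $v$ with label $i$; $\eta_{i,j}$ (for $i\neq j$) creates an edge between every vertex with label $i$ and every vertex with label $j$; $\rho_{i\to j}$ changes all labels $i$ to $j$; $\oplus$ forms the disjoint union of two labeled graphs. The generated graph is obtained by finally deleting the labels. The clique-width $\mathrm{cw}(G)$ is the smallest $k$ such that $G$ is generated by a $k$-expression. A $k$-fusion-tree expression is an expression built from atoms $i\langle m\rangle$, unary operations $\eta_{i,j}$, $\rho_{i\to j}$, $\theta_i$, and the binary operation $\oplus$, with labels $i,j\in\{1,\dots,k\}$, where: $i\langle m\rangle$ creates a graph consisting of $m$ isolated vertices labeled $i$; $\eta_{i,j}$ (for $i\ne j$) creates an edge between every vertex with label $i$ and every vertex with label $j$; $\rho_{i\to j}$ changes all labels $i$ to $j$; $\oplus$ forms the disjoint union of two labeled graphs; $\theta_i$ merges all vertices labeled $i$ into one vertex, which is labeled $i$ and is adjacent to every vertex not labeled $i$ to which some vertex labeled $i$ was adjacent before the operation. The generated graph is obtained by finally deleting all labels. The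 fusion-width $\mathrm{fw}(G)$ is the smallest $k$ such that there is a $k$-fusion-tree expression generating $G$. -}

module Defs where

open import Data.Empty using (⊥)
open import Data.Fin.Base using (Fin)
open import Data.Fin.Properties using (_≟_)
open import Data.Nat.Base using (ℕ; suc; _+_; _≤_; NonZero)
open import Data.Product.Base using (_×_; _,_; proj₁; ∃-syntax; ∃₂; Σ-syntax)
open import Data.Sum.Base using (_⊎_; inj₁; inj₂; [_,_])
open import Data.Sum.Relation.Binary.Pointwise
  using (Pointwise; inj₁; inj₂; _⊎ₛ_; ⊎-symmetric; ⊎-irreflexive; ⊎-respects₂)
open import Function.Base using (_∘_)
open import Function.Bundles using (Inverse; _⇔_)
open import Level using (0ℓ) renaming (suc to lsuc)
open import Relation.Binary.Bundles using (Setoid)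
open import Relation.Binary.Core using (Rel)
open import Relation.Binary.Definitions
  using (Symmetric; Irreflexive; Reflexive; Transitive; _Respects₂_)
open import Relation.Binary.PropositionalEquality
  using (_≡_; _≢_; refl; sym; trans; cong; setoid)
open import Relation.Nullary.Decidable.Core using (yes; no)
open import Relation.Nullary.Negation.Core using (¬_)

-- Simple undirected graphs. The vertices form a setoid, so that merging
-- vertices is passing to a coarser vertex equality.
record Graph : Set (lsuc 0ℓ) where
  field
    vertices : Setoid 0ℓ 0ℓ

  open Setoid vertices public
    using (_≈_) renaming (Carrier to Vertex; refl to ≈-refl; sym to ≈-sym; trans to ≈-trans)

  field
    Adj        : Rel Vertex 0ℓ
    Adj-sym    : Symmetric Adj
    Adj-irrefl : Irreflexive _≈_ Adj
    Adj-resp   : Adj Respects₂ _≈_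

Finite : Graph → Set
Finite G = ∃[ n ] Inverse (setoid (Fin n)) (Graph.vertices G)

Nonempty : Graph → Set
Nonempty G = Graph.Vertex G

infix 4 _≅_

record _≅_ (G H : Graph) : Set where
  private
    module G = Graph G
    module H = Graph H
  field
    bijection : Inverse G.vertices H.vertices

  open Inverse bijection public using (to; from)

  field
    Adj⇔ : ∀ u v → G.Adj u v ⇔ H.Adj (to u) (to v)

record LabelledGraph (k : ℕ) : Set (lsuc 0ℓ) where
  field
    graph : Graph

  open Graph graph public

  field
    label      : Vertex → Fin k
    label-cong : ∀ {u v} → u ≈ v → label u ≡ label v

module _ {k : ℕ} where

  isolated : Fin k → ℕ → LabelledGraph k
  isolated i m = record
    { graph = record
      { vertices   = setoid (Fin m)
      ; Adj        = λ _ _ → ⊥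
      ; Adj-sym    = λ ()
      ; Adj-irrefl = λ _ ()
      ; Adj-resp   = (λ _ ()) , (λ _ ())
      }
    ; label      = λ _ → i
    ; label-cong = λ _ → refl
    }

  module _ (i j : Fin k) (i≢j : i ≢ j) (H : LabelledGraph k) where
    open LabelledGraph H

    JoinAdj : Rel Vertex 0ℓ
    JoinAdj u v = Adj u v ⊎ (label u ≡ i × label v ≡ j) ⊎ (label u ≡ j × label v ≡ i)

    private
      joinSym : Symmetric JoinAdj
      joinSym (inj₁ a)              = inj₁ (Adj-sym a)
      joinSym (inj₂ (inj₁ (p , q))) = inj₂ (inj₂ (q , p))
      joinSym (inj₂ (inj₂ (p , q))) = inj₂ (inj₁ (q , p))

      joinIrrefl : Irreflexive _≈_ JoinAdj
      joinIrrefl e (inj₁ a)              = Adj-irrefl e a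
      joinIrrefl e (inj₂ (inj₁ (p , q))) = i≢j (trans (sym p) (trans (label-cong e) q))
      joinIrrefl e (inj₂ (inj₂ (p , q))) = i≢j (trans (sym q) (trans (sym (label-cong e)) p))

      joinRespʳ : ∀ {u v w} → v ≈ w → JoinAdj u v → JoinAdj u w
      joinRespʳ e (inj₁ a)              = inj₁ (proj₁ Adj-resp e a)
      joinRespʳ e (inj₂ (inj₁ (p , q))) = inj₂ (inj₁ (p , trans (sym (label-cong e)) q))
      joinRespʳ e (inj₂ (inj₂ (p , q))) = inj₂ (inj₂ (p , trans (sym (label-cong e)) q))

    join : LabelledGraph k
    join = record
      { graph = record
        { vertices   = vertices
        ; Adj        = JoinAdj
        ; Adj-sym    = joinSym
        ; Adj-irrefl = joinIrrefl
        ; Adj-resp   = joinRespʳ , λ e → joinSym ∘ joinRespʳ e ∘ joinSym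
        }
      ; label      = label
      ; label-cong = label-cong
      }

  rename : Fin k → Fin k → Fin k → Fin k
  rename i j l with l ≟ i
  ... | yes _ = j
  ... | no  _ = l

  relabel : Fin k → Fin k → LabelledGraph k → LabelledGraph k
  relabel i j H = record
    { graph      = graph
    ; label      = rename i j ∘ label
    ; label-cong = cong (rename i j) ∘ label-cong
    }
    where open LabelledGraph H

  disjointUnion : LabelledGraph k → LabelledGraph k → LabelledGraph k
  disjointUnion H K = record
    { graph = record
      { vertices   = H.vertices ⊎ₛ K.vertices
      ; Adj        = Pointwise H.Adj K.Adj
      ; Adj-sym    = ⊎-symmetric H.Adj-sym K.Adj-sym
      ; Adj-irrefl = ⊎-irreflexive H.Adj-irrefl K.Adj-irrefl
      ; Adj-resp   = ⊎-respects₂ H.Adj-resp K.Adj-resp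
      }
    ; label      = [ H.label , K.label ]
    ; label-cong = λ { (inj₁ e) → H.label-cong e ; (inj₂ e) → K.label-cong e }
    }
    where
    module H = LabelledGraph H
    module K = LabelledGraph K

  module _ (i : Fin k) (H : LabelledGraph k) where
    open LabelledGraph H

    Merged : Rel Vertex 0ℓ
    Merged u v = u ≈ v ⊎ (label u ≡ i × label v ≡ i)

    -- Adjacency of classes: distinct classes with adjacent representatives.
    MergedAdj : Rel Vertex 0ℓ
    MergedAdj u v = ¬ Merged u v × ∃₂ λ u′ v′ → Merged u u′ × Merged v v′ × Adj u′ v′

    private
      mRefl : Reflexive Merged
      mRefl = inj₁ ≈-refl

      mSym : Symmetric Merged
      mSym (inj₁ e)       = inj₁ (≈-sym e)
      mSym (inj₂ (p , q)) = inj₂ (q , p)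

      mTrans : Transitive Merged
      mTrans (inj₁ e)       (inj₁ f)       = inj₁ (≈-trans e f)
      mTrans (inj₁ e)       (inj₂ (p , q)) = inj₂ (trans (label-cong e) p , q)
      mTrans (inj₂ (p , q)) (inj₁ f)       = inj₂ (p , trans (sym (label-cong f)) q)
      mTrans (inj₂ (p , _)) (inj₂ (_ , q)) = inj₂ (p , q)

      mAdjSym : Symmetric MergedAdj
      mAdjSym (n , u′ , v′ , p , q , a) = n ∘ mSym , v′ , u′ , q , p , Adj-sym a

      mAdjRespʳ : ∀ {u v w} → Merged v w → MergedAdj u v → MergedAdj u w
      mAdjRespʳ e (n , u′ , v′ , p , q , a) =
        (λ f → n (mTrans f (mSym e))) , u′ , v′ , p , mTrans (mSym e) q , a

      mLabel : ∀ {u v} → Merged u v → label u ≡ label v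
      mLabel (inj₁ e)       = label-cong e
      mLabel (inj₂ (p , q)) = trans p (sym q)

    merge : LabelledGraph k
    merge = record
      { graph = record
        { vertices = record
          { Carrier       = Vertex
          ; _≈_           = Merged
          ; isEquivalence = record { refl = mRefl ; sym = mSym ; trans = mTrans }
          }
        ; Adj        = MergedAdj
        ; Adj-sym    = mAdjSym
        ; Adj-irrefl = λ e (n , _) → n e
        ; Adj-resp   = mAdjRespʳ , λ e → mAdjSym ∘ mAdjRespʳ e ∘ mAdjSym
        }
      ; label      = label
      ; label-cong = mLabel
      }

-- The vertex of an atom carries no name: generation is up to isomorphism.
data Expr (k : ℕ) : Set where
  atom : (i : Fin k) → Expr k
  η    : (i j : Fin k) → i ≢ j → Expr k → Expr k
  ρ    : (i j : Fin k) → Expr k → Expr k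
  _⊕_  : Expr k → Expr k → Expr k

-- Graphs are nonempty, hence m is nonzero in i⟨m⟩.
data FusionExpr (k : ℕ) : Set where
  _⟨_⟩ : (i : Fin k) (m : ℕ) .{{_ : NonZero m}} → FusionExpr k
  η    : (i j : Fin k) → i ≢ j → FusionExpr k → FusionExpr k
  ρ    : (i j : Fin k) → FusionExpr k → FusionExpr k
  θ    : (i : Fin k) → FusionExpr k → FusionExpr k
  _⊕_  : FusionExpr k → FusionExpr k → FusionExpr k

module _ {k : ℕ} where

  ⟦_⟧ : Expr k → LabelledGraph k
  ⟦ atom i ⟧      = isolated i 1
  ⟦ η i j i≢j e ⟧ = join i j i≢j ⟦ e ⟧
  ⟦ ρ i j e ⟧     = relabel i j ⟦ e ⟧
  ⟦ d ⊕ e ⟧       = disjointUnion ⟦ d ⟧ ⟦ e ⟧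

  ⟦_⟧ᶠ : FusionExpr k → LabelledGraph k
  ⟦ i ⟨ m ⟩ ⟧ᶠ     = isolated i m
  ⟦ η i j i≢j e ⟧ᶠ = join i j i≢j ⟦ e ⟧ᶠ
  ⟦ ρ i j e ⟧ᶠ     = relabel i j ⟦ e ⟧ᶠ
  ⟦ θ i e ⟧ᶠ       = merge i ⟦ e ⟧ᶠ
  ⟦ d ⊕ e ⟧ᶠ       = disjointUnion ⟦ d ⟧ᶠ ⟦ e ⟧ᶠ

  -- Atoms are the operands, not operations.
  operations : Expr k → ℕ
  operations (atom i)    = 0
  operations (η _ _ _ e) = suc (operations e)
  operations (ρ _ _ e)   = suc (operations e)
  operations (d ⊕ e)     = suc (operations d + operations e)

  operationsᶠ : FusionExpr k → ℕ
  operationsᶠ (i ⟨ m ⟩)   = 0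
  operationsᶠ (η _ _ _ e) = suc (operationsᶠ e)
  operationsᶠ (ρ _ _ e)   = suc (operationsᶠ e)
  operationsᶠ (θ _ e)     = suc (operationsᶠ e)
  operationsᶠ (d ⊕ e)     = suc (operationsᶠ d + operationsᶠ e)

  infix 4 _Generates_ _Generatesᶠ_

  _Generates_ : Expr k → Graph → Set
  e Generates G = LabelledGraph.graph ⟦ e ⟧ ≅ G

  _Generatesᶠ_ : FusionExpr k → Graph → Set
  e Generatesᶠ G = LabelledGraph.graph ⟦ e ⟧ᶠ ≅ G

IsLeast : (ℕ → Set) → ℕ → Set
IsLeast P k = P k × (∀ j → P j → k ≤ j)

IsCliqueWidth : Graph → ℕ → Set
IsCliqueWidth G = IsLeast (λ k → Σ[ e ∈ Expr k ] e Generates G)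

IsFusionWidth : Graph → ℕ → Set
IsFusionWidth G = IsLeast (λ k → Σ[ e ∈ FusionExpr k ] e Generatesᶠ G)

{-# OPTIONS --safe #-}
module Submission where

-- Every operation of a k-expression is a fusion-tree operation, with i⟨1⟩ for the atom i(v),
-- so a k-expression is already a k-fusion-tree expression. What remains is that the least
-- number of labels can be found, for which it must be decidable whether G has a j-fusion-tree
-- expression. The graphs of its subexpressions may be arbitrarily large, but each of their
-- vertices ends up as a vertex of G, its target. All that matters for the later operations is
-- how many vertices (none, one or several) there are of each target and label, and which pairs
-- of targets are joined by an edge. These data form a finite set of states on which the
-- operations act, with θ allowed only on labels whose vertices share one target. Saturating
-- this set decides whether a state representing G is reachable.

open import Defs
open import Data.Empty using (⊥; ⊥-elim)
open import Data.Fin.Base using (Fin; zero; suc; finToFun; funToFin)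
open import Data.Fin.Patterns using (0F; 1F; 2F)
open import Data.Fin.Properties using (_≟_; any?; all?; finToFun-funToFin)
open import Data.List.Base using (List; []; _∷_; _++_; length; allFin; cartesianProduct)
open import Data.List.Membership.Propositional using (_∈_; find; lose)
open import Data.List.Membership.Propositional.Properties
  using (∈-∃++; ∈-++⁺ˡ; ∈-++⁺ʳ; ∈-++⁻; ∈-cartesianProduct⁺; ∈-allFin)
open import Data.List.Properties using (length-++)
open import Data.List.Relation.Unary.All as All using (All; []; _∷_)
open import Data.List.Relation.Unary.Any as Any using (Any; here; there)
open import Data.Nat.Base using (ℕ; zero; suc; _+_; _^_; _≤_; _<_; NonZero; ≢-nonZero⁻¹)
open import Data.Nat.Induction using (<-rec; <-wellFounded)
open import Data.Nat.Properties
  using (≤-refl; ≤-reflexive; ≤-trans; <⇒≤; ≮⇒≥; anyUpTo?; +-suc)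
open import Data.Product.Base using (_×_; _,_; proj₁; proj₂; ∃; ∃₂; ∃-syntax; Σ-syntax)
open import Data.Product.Properties using (≡-dec)
open import Data.Sum.Base using (_⊎_; inj₁; inj₂; [_,_]′)
open import Data.Sum.Relation.Binary.Pointwise using (inj₁; inj₂)
open import Function.Base using (_∘_; id; const)
open import Function.Bundles using (Inverse; Equivalence; _⇔_; mk⇔)
open import Function.Construct.Composition using (_⇔-∘_; inverse)
open import Function.Construct.Symmetry using () renaming (inverse to inverse-sym)
open import Induction.WellFounded using (Acc; acc)
open import Level using (0ℓ)
open import Relation.Binary.Bundles using (Setoid)
open import Relation.Binary.PropositionalEquality
  using (_≡_; _≢_; refl; sym; trans; cong; cong₂; subst; setoid)
open import Relation.Nullary.Decidable
  using (Dec; yes; no; map′; ¬?; _×-dec_; _⊎-dec_; _→-dec_)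
open import Relation.Nullary.Negation.Core using (¬_; contradiction)
open import Relation.Unary using (Decidable)

private variable
  n k : ℕ

-- Counting solutions up to two

infixl 6 _⊹_

-- Addition capped at two, where `2F` stands for two or more.
_⊹_ : Fin 3 → Fin 3 → Fin 3
0F      ⊹ b       = b
(suc a) ⊹ 0F      = suc a
(suc _) ⊹ (suc _) = 2F

cap : Fin 3 → Fin 3
cap 0F      = 0F
cap (suc _) = 1F

module _ (X : Setoid 0ℓ 0ℓ) where

  open Setoid X using (Carrier; _≈_)

  -- The constructors carry witnesses, so vertices can be extracted from a positive count although
  -- `P` and `≈` come with no decision procedure.
  data Counts (P : Carrier → Set) : Fin 3 → Set where
    none : (∀ v → ¬ P v) → Counts P 0F
    one  : ∀ v → P v → (∀ w → P w → v ≈ w) → Counts P 1F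
    many : ∀ v w → P v → P w → ¬ (v ≈ w) → Counts P 2F

module _ {X : Setoid 0ℓ 0ℓ} {P : Setoid.Carrier X → Set} where

  open Setoid X using (Carrier; _≈_)

  positive⇒solution : ∀ {c} → Counts X P c → c ≢ 0F → ∃ P
  positive⇒solution (none _)         c≢0 = contradiction refl c≢0
  positive⇒solution (one v p _)      _   = v , p
  positive⇒solution (many v _ p _ _) _   = v , p

  solution⇒positive : ∀ {c} → Counts X P c → ∃ P → c ≢ 0F
  solution⇒positive (none h)         (v , p) _ = h v p
  solution⇒positive (one _ _ _)      _       ()
  solution⇒positive (many _ _ _ _ _) _       ()

  unique⇒1 : ∀ {c} → Counts X P c → ∀ {v} → P v → (∀ w → P w → v ≈ w) → c ≡ 1F
  unique⇒1 (none h)         p _ = contradiction p (h _)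
  unique⇒1 (one _ _ _)      _ _ = refl
  unique⇒1 (many x y p q x≉y) _ u =
    contradiction (Setoid.trans X (Setoid.sym X (u x p)) (u y q)) x≉y

  0⇒empty : ∀ {c} → Counts X P c → c ≡ 0F → ∀ v → ¬ P v
  0⇒empty (none h) _ = h

  empty⇒0 : ∀ {c} → Counts X P c → (∀ v → ¬ P v) → c ≡ 0F
  empty⇒0 (none _)         _ = refl
  empty⇒0 (one v p _)      h = contradiction p (h v)
  empty⇒0 (many v _ p _ _) h = contradiction p (h v)

  1⇒unique : ∀ {c} → Counts X P c → c ≡ 1F → ∃ λ v → P v × (∀ w → P w → v ≈ w)
  1⇒unique (one v p u) _ = v , p , u

  Counts-resp : ∀ {c} {Q : Carrier → Set} → (∀ v → P v ⇔ Q v) → Counts X P c → Counts X Q c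
  Counts-resp P⇔Q = go
    where
    to : ∀ {v} → P v → _
    to = Equivalence.to (P⇔Q _)
    from : ∀ {v} → _ → P v
    from = Equivalence.from (P⇔Q _)
    go : ∀ {c} → Counts X P c → Counts X _ c
    go (none h)           = none (λ v → h v ∘ from)
    go (one v p u)        = one v (to p) (λ w → u w ∘ from)
    go (many v w p q v≉w) = many v w (to p) (to q) v≉w

module _ {X Y Z : Setoid 0ℓ 0ℓ} where

  private
    module X = Setoid X
    module Y = Setoid Y
    module Z = Setoid Z

  module _
    {P : X.Carrier → Set} {Q : Y.Carrier → Set} {R : Z.Carrier → Set}
    (f : X.Carrier → Z.Carrier) (g : Y.Carrier → Z.Carrier)
    (f-cong : ∀ {u v} → u X.≈ v → f u Z.≈ f v) (f-inj : ∀ {u v} → f u Z.≈ f v → u X.≈ v)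
    (g-cong : ∀ {u v} → u Y.≈ v → g u Z.≈ g v) (g-inj : ∀ {u v} → g u Z.≈ g v → u Y.≈ v)
    (separated : ∀ {u v} → P u → Q v → ¬ (f u Z.≈ g v))
    (P⇒R : ∀ {u} → P u → R (f u)) (Q⇒R : ∀ {v} → Q v → R (g v))
    (split : ∀ z → R z → (∃ λ u → P u × f u Z.≈ z) ⊎ (∃ λ v → Q v × g v Z.≈ z))
    where

    -- The solutions of `R` split into disjoint embedded copies of those of `P` and `Q`. This serves
    -- disjoint unions, the fusing of two labels by `ρ` and the growth of `i⟨m⟩` by a vertex.
    Counts-⊹ : ∀ {a b} → Counts X P a → Counts Y Q b → Counts Z R (a ⊹ b)
    -- One solution from each side already gives two distinct ones.
    Counts-⊹ {suc _} {suc _} p q =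
      let u , Pu = positive⇒solution p λ () ; v , Qv = positive⇒solution q λ () in
      many (f u) (g v) (P⇒R Pu) (Q⇒R Qv) (separated Pu Qv)
    Counts-⊹ (none h) (none h′) =
      none λ z r → [ (λ (u , p , _) → h u p) , (λ (v , q , _) → h′ v q) ]′ (split z r)
    Counts-⊹ (none h) (one v q unique) = one (g v) (Q⇒R q) λ z r →
      [ (λ (u , p , _) → contradiction p (h u))
      , (λ (w , q′ , e) → Z.trans (g-cong (unique w q′)) e) ]′ (split z r)
    Counts-⊹ (none _) (many v w p q v≉w) = many (g v) (g w) (Q⇒R p) (Q⇒R q) (v≉w ∘ g-inj)
    Counts-⊹ (one v p unique) (none h) = one (f v) (P⇒R p) λ z r →
      [ (λ (w , p′ , e) → Z.trans (f-cong (unique w p′)) e)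
      , (λ (u , q , _) → contradiction q (h u)) ]′ (split z r)
    Counts-⊹ (many v w p q v≉w) (none _) = many (f v) (f w) (P⇒R p) (P⇒R q) (v≉w ∘ f-inj)

-- States of labelled graphs over a set of targets

indicator : ∀ {A : Set} → Dec A → Fin 2
indicator (yes _) = 1F
indicator (no  _) = 0F

indicator⇔ : ∀ {A : Set} (d : Dec A) → indicator d ≡ 1F ⇔ A
indicator⇔ (yes a) = mk⇔ (const a) (const refl)
indicator⇔ (no ¬a) = mk⇔ (λ ()) (λ a → contradiction a ¬a)

-- Matrices are coded as numbers, which have decidable equality and can be listed without function
-- extensionality.
decode : ∀ {m n a} → Fin ((a ^ n) ^ m) → Fin m → Fin n → Fin a
decode {m} {n} {a} x t = finToFun {a} {n} (finToFun {a ^ n} {m} x t)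

encode : ∀ {m n a} → (Fin m → Fin n → Fin a) → Fin ((a ^ n) ^ m)
encode f = funToFin (funToFin ∘ f)

decode-encode : ∀ {m n a} (f : Fin m → Fin n → Fin a) t u →
  decode {m} {n} {a} (encode f) t u ≡ f t u
decode-encode f t u = trans
  (cong (λ x → finToFun x u) (finToFun-funToFin (funToFin ∘ f) t))
  (finToFun-funToFin (f t) u)

abstract

  -- For every target and label the number of vertices, capped at two; for
  -- every pair of targets whether an edge joins them.
  State : ℕ → ℕ → Set
  State n k = Fin ((3 ^ k) ^ n) × Fin ((2 ^ n) ^ n)

  _≟ˢ_ : (s s′ : State n k) → Dec (s ≡ s′)
  _≟ˢ_ = ≡-dec _≟_ _≟_

  states : ∀ n k → List (State n k)
  states n k = cartesianProduct (allFin _) (allFin _)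

  ∈-states : (s : State n k) → s ∈ states n k
  ∈-states (c , e) = ∈-cartesianProduct⁺ (∈-allFin c) (∈-allFin e)

  count : State n k → Fin n → Fin k → Fin 3
  count {n} (c , _) t l = decode {n} c t l

  HasEdge : State n k → Fin n → Fin n → Set
  HasEdge {n} (_ , e) t t′ = decode {n} e t t′ ≡ 1F

  hasEdge? : (s : State n k) (t t′ : Fin n) → Dec (HasEdge s t t′)
  hasEdge? s t t′ = _ ≟ _

  state : (c : Fin n → Fin k → Fin 3) {E : Fin n → Fin n → Set} → (∀ t t′ → Dec (E t t′)) →
    State n k
  state c E? = encode c , encode (λ t t′ → indicator (E? t t′))

  count-state : ∀ (c : Fin n → Fin k → Fin 3) {E : Fin n → Fin n → Set}
    (E? : ∀ t t′ → Dec (E t t′)) t l → count (state c E?) t l ≡ c t l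
  count-state c _ = decode-encode c

  hasEdge-state : ∀ (c : Fin n → Fin k → Fin 3) {E : Fin n → Fin n → Set}
    (E? : ∀ t t′ → Dec (E t t′)) t t′ → HasEdge (state c E?) t t′ ⇔ E t t′
  hasEdge-state _ E? t t′ =
    subst (λ x → x ≡ 1F ⇔ _) (sym (decode-encode (λ t t′ → indicator (E? t t′)) t t′))
      (indicator⇔ (E? t t′))

Present : State n k → Fin n → Fin k → Set
Present s t l = count s t l ≢ 0F

present? : (s : State n k) (t : Fin n) (l : Fin k) → Dec (Present s t l)
present? s t l = ¬? (count s t l ≟ 0F)

module _ {n k} (H : LabelledGraph k) (φ : LabelledGraph.Vertex H → Fin n) where

  open LabelledGraph H

  At : Fin n → Fin k → Vertex → Set
  At t l v = φ v ≡ t × label v ≡ l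

  -- Edges between vertices of the same target are left out: these vertices must end up as one
  -- vertex of `G`, and merging discards the edges between them.
  Crossing : Fin n → Fin n → Set
  Crossing t t′ = t ≢ t′ × ∃₂ λ u v → φ u ≡ t × φ v ≡ t′ × Adj u v

  record Describes (s : State n k) : Set where
    field
      φ-cong : ∀ {u v} → u ≈ v → φ u ≡ φ v
      counts : ∀ t l → Counts vertices (At t l) (count s t l)
      edges  : ∀ t t′ → HasEdge s t t′ ⇔ Crossing t t′

    present⇒vertex : ∀ {t l} → Present s t l → ∃ (At t l)
    present⇒vertex = positive⇒solution (counts _ _)

    vertex⇒present : ∀ {t l} → ∃ (At t l) → Present s t l
    vertex⇒present = solution⇒positive (counts _ _)

  describes-state : ∀ {c} {E : Fin n → Fin n → Set} (E? : ∀ t t′ → Dec (E t t′)) →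
    (∀ {u v} → u ≈ v → φ u ≡ φ v) →
    (∀ t l → Counts vertices (At t l) (c t l)) →
    (∀ t t′ → E t t′ ⇔ Crossing t t′) →
    Describes (state c E?)
  describes-state {c} E? φ-cong counts edges = record
    { φ-cong = φ-cong
    ; counts = λ t l → subst (Counts vertices (At t l)) (sym (count-state c E? t l)) (counts t l)
    ; edges  = λ t t′ → edges t t′ ⇔-∘ hasEdge-state c E? t t′
    }

-- Operations on states

singletonCount : Fin n → Fin k → Fin n → Fin k → Fin 3
singletonCount t i t′ l with t ≟ t′ ×-dec i ≟ l
... | yes _ = 1F
... | no  _ = 0F

singletonˢ : Fin n → Fin k → State n k
singletonˢ t i = state (singletonCount t i) {λ _ _ → ⊥} (λ _ _ → no id)

describes-singleton : (i : Fin k) (φ : Fin 1 → Fin n) →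
  Describes (isolated i 1) φ (singletonˢ (φ 0F) i)
describes-singleton i φ = describes-state (isolated i 1) φ _ (cong φ) counts
  (λ _ _ → mk⇔ (λ ()) (λ ()))
  where
  counts : ∀ t l → Counts _ (At (isolated i 1) φ t l) (singletonCount (φ 0F) i t l)
  counts t l with φ 0F ≟ t ×-dec i ≟ l
  ... | yes p = one 0F p λ { 0F _ → refl }
  ... | no ¬p = none λ { 0F → ¬p }

module _ (i j : Fin k) (s : State n k) where

  -- The new edges depend only on which labels occur at each target. Those inside one target are
  -- dropped, as in `Crossing`.
  JoinEdge : Fin n → Fin n → Set
  JoinEdge t t′ = HasEdge s t t′ ⊎
    t ≢ t′ × (Present s t i × Present s t′ j ⊎ Present s t j × Present s t′ i)

  joinEdge? : ∀ t t′ → Dec (JoinEdge t t′)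
  joinEdge? t t′ = hasEdge? s t t′ ⊎-dec
    ¬? (t ≟ t′) ×-dec
      (present? s t i ×-dec present? s t′ j ⊎-dec present? s t j ×-dec present? s t′ i)

  joinˢ : State n k
  joinˢ = state (count s) joinEdge?

describes-join : ∀ {i j : Fin k} i≢j {H φ} {s : State n k} →
  Describes H φ s → Describes (join i j i≢j H) φ (joinˢ i j s)
describes-join {i = i} {j} i≢j {H} {φ} {s} d =
  describes-state (join i j i≢j H) φ (joinEdge? i j s) φ-cong counts λ t t′ → mk⇔ to from
  where
  open Describes d
  to : ∀ {t t′} → JoinEdge i j s t t′ → Crossing (join i j i≢j H) φ t t′
  to (inj₁ e) =
    let t≢t′ , u , v , p , q , a = Equivalence.to (edges _ _) e in
    t≢t′ , u , v , p , q , inj₁ a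
  to (inj₂ (t≢t′ , inj₁ (x , y))) =
    let u , p , l = present⇒vertex x ; v , q , m = present⇒vertex y in
    t≢t′ , u , v , p , q , inj₂ (inj₁ (l , m))
  to (inj₂ (t≢t′ , inj₂ (x , y))) =
    let u , p , l = present⇒vertex x ; v , q , m = present⇒vertex y in
    t≢t′ , u , v , p , q , inj₂ (inj₂ (l , m))
  from : ∀ {t t′} → Crossing (join i j i≢j H) φ t t′ → JoinEdge i j s t t′
  from (t≢t′ , u , v , p , q , inj₁ a) =
    inj₁ (Equivalence.from (edges _ _) (t≢t′ , u , v , p , q , a))
  from (t≢t′ , u , v , p , q , inj₂ (inj₁ (l , m))) =
    inj₂ (t≢t′ , inj₁ (vertex⇒present (u , p , l) , vertex⇒present (v , q , m)))
  from (t≢t′ , u , v , p , q , inj₂ (inj₂ (l , m))) =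
    inj₂ (t≢t′ , inj₂ (vertex⇒present (u , p , l) , vertex⇒present (v , q , m)))

rename-source : (i j : Fin k) → rename i j i ≡ j
rename-source i j with i ≟ i
... | yes _  = refl
... | no i≢i = contradiction refl i≢i

rename-other : ∀ {i j l : Fin k} → l ≢ i → rename i j l ≡ l
rename-other {i = i} {l = l} l≢i with l ≟ i
... | yes l≡i = contradiction l≡i l≢i
... | no _    = refl

rename-identity : (i l : Fin k) → rename i i l ≡ l
rename-identity i l with l ≟ i
... | yes l≡i = sym l≡i
... | no _    = refl

rename-preimage : (i j {l m} : Fin k) → rename i j l ≡ m → (l ≡ i × m ≡ j) ⊎ (l ≢ i × l ≡ m)
rename-preimage i j {l} e with l ≟ i
... | yes l≡i = inj₁ (l≡i , sym e)
... | no l≢i  = inj₂ (l≢i , e)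

-- The case `i ≡ j` is taken first: renaming is then the identity, and the sum in the second clause
-- would count the same vertices twice.
relabelCount : Fin k → Fin k → (Fin n → Fin k → Fin 3) → Fin n → Fin k → Fin 3
relabelCount i j c t l with i ≟ j | l ≟ j | l ≟ i
... | yes _ | _     | _     = c t l
... | no _  | yes _ | _     = c t i ⊹ c t j
... | no _  | no _  | yes _ = 0F
... | no _  | no _  | no _  = c t l

relabelˢ : Fin k → Fin k → State n k → State n k
relabelˢ i j s = state (relabelCount i j (count s)) (hasEdge? s)

describes-relabel : ∀ {i j : Fin k} {H φ} {s : State n k} →
  Describes H φ s → Describes (relabel i j H) φ (relabelˢ i j s)
describes-relabel {i = i} {j} {H} {φ} {s} d =
  describes-state (relabel i j H) φ (hasEdge? s) φ-cong relabelled edges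
  where
  open Describes d
  open LabelledGraph H
  relabelled : ∀ t l →
    Counts vertices (At (relabel i j H) φ t l) (relabelCount i j (count s) t l)
  relabelled t l with i ≟ j | l ≟ j | l ≟ i
  ... | yes refl | _ | _ = Counts-resp
    (λ v → mk⇔ (λ (p , q) → p , trans (rename-identity i _) q)
               (λ (p , q) → p , trans (sym (rename-identity i _)) q))
    (counts t l)
  -- After renaming, label `j` is carried by the former `i`- and `j`-vertices, which are disjoint
  -- since `i ≢ j`.
  ... | no i≢j | yes refl | _ = Counts-⊹ id id id id id id
    (λ (_ , p) (_ , q) e → i≢j (trans (sym p) (trans (label-cong e) q)))
    (λ (p , q) → p , trans (cong (rename i j) q) (rename-source i j))
    (λ { (p , q) → p , trans (rename-other (λ e → i≢j (trans (sym e) q))) q })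
    (λ v (p , q) → [ (λ (e , _) → inj₁ (v , (p , e) , ≈-refl))
                   , (λ (_ , e) → inj₂ (v , (p , e) , ≈-refl)) ]′ (rename-preimage i j q))
    (counts t i) (counts t j)
  ... | no i≢j | no l≢j | yes refl = none λ v (_ , q) →
    [ (λ (_ , e) → l≢j e) , (λ (≢i , e) → ≢i e) ]′ (rename-preimage i j {label v} q)
  ... | no i≢j | no l≢j | no l≢i = Counts-resp
    (λ v → mk⇔ (λ { (p , refl) → p , rename-other l≢i })
               (λ (p , q) → p ,
                 [ (λ (_ , e) → contradiction e l≢j) , proj₂ ]′ (rename-preimage i j q)))
    (counts t l)

unionˢ : State n k → State n k → State n k
unionˢ s s′ = state (λ t l → count s t l ⊹ count s′ t l)
  (λ t t′ → hasEdge? s t t′ ⊎-dec hasEdge? s′ t t′)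

describes-union : ∀ {H K : LabelledGraph k} {φ} {s s′ : State n k} →
  Describes H (φ ∘ inj₁) s → Describes K (φ ∘ inj₂) s′ →
  Describes (disjointUnion H K) φ (unionˢ s s′)
describes-union {H = H} {K} {φ} {s} {s′} d d′ = describes-state (disjointUnion H K) φ _
  (λ { (inj₁ e) → d.φ-cong e ; (inj₂ e) → d′.φ-cong e })
  (λ t l → Counts-⊹ inj₁ inj₂ inj₁ (λ { (inj₁ e) → e }) inj₂ (λ { (inj₂ e) → e })
    (λ _ _ ()) id id
    (λ { (inj₁ v) r → inj₁ (v , r , inj₁ H.≈-refl) ; (inj₂ v) r → inj₂ (v , r , inj₂ K.≈-refl) })
    (d.counts t l) (d′.counts t l))
  (λ t t′ → mk⇔
    [ (λ e → let t≢t′ , u , v , p , q , a = Equivalence.to (d.edges t t′) e in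
         t≢t′ , inj₁ u , inj₁ v , p , q , inj₁ a)
    , (λ e → let t≢t′ , u , v , p , q , a = Equivalence.to (d′.edges t t′) e in
         t≢t′ , inj₂ u , inj₂ v , p , q , inj₂ a) ]′
    λ { (t≢t′ , _ , _ , p , q , inj₁ a) →
          inj₁ (Equivalence.from (d.edges t t′) (t≢t′ , _ , _ , p , q , a))
      ; (t≢t′ , _ , _ , p , q , inj₂ a) →
          inj₂ (Equivalence.from (d′.edges t t′) (t≢t′ , _ , _ , p , q , a)) })
  where
  module d = Describes d
  module d′ = Describes d′
  module H = LabelledGraph H
  module K = LabelledGraph K

-- Splitting off the vertex `0F` leaves a copy of `isolated i m`, so the counts add up as in a
-- disjoint union; there are no edges on either side.
describes-isolated-suc : ∀ {i : Fin k} {m} {φ : Fin (suc m) → Fin n} {s : State n k} →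
  Describes (isolated i m) (φ ∘ suc) s →
  Describes (isolated i (suc m)) φ (unionˢ (singletonˢ (φ 0F) i) s)
describes-isolated-suc {i = i} {m} {φ} {s} d = describes-state (isolated i (suc m)) φ _
  (cong φ)
  (λ t l → Counts-⊹ (const 0F) suc (const refl) (λ { {0F} {0F} _ → refl ; {suc ()} ; {0F} {suc ()} })
    (cong suc) (λ { refl → refl }) (λ _ _ ())
    (λ { {0F} p → p ; {suc ()} }) id
    (λ { 0F r → inj₁ (0F , r , refl) ; (suc v) r → inj₂ (v , r , refl) })
    (d₀.counts t l) (d.counts t l))
  (λ t t′ → mk⇔
    [ (λ e → ⊥-elim (noCrossing (Equivalence.to (d₀.edges t t′) e)))
    , (λ e → ⊥-elim (noCrossing (Equivalence.to (d.edges t t′) e))) ]′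
    λ c → ⊥-elim (noCrossing c))
  where
  module d = Describes d
  module d₀ = Describes (describes-singleton i (λ _ → φ 0F))
  noCrossing : ∀ {m φ t t′} → ¬ Crossing (isolated i m) φ t t′
  noCrossing (_ , _ , _ , _ , _ , ())

-- All vertices labelled `i` become one vertex under `θ`, so they need a common target.
Mergeable : Fin k → State n k → Set
Mergeable i s = ∀ t t′ → Present s t i → Present s t′ i → t ≡ t′

mergeable? : (i : Fin k) (s : State n k) → Dec (Mergeable i s)
mergeable? i s = all? λ t → all? λ t′ → present? s t i →-dec present? s t′ i →-dec t ≟ t′

mergeCount : Fin k → (Fin n → Fin k → Fin 3) → Fin n → Fin k → Fin 3
mergeCount i c t l with l ≟ i
... | yes _ = cap (c t l)
... | no  _ = c t l

mergeˢ : Fin k → State n k → State n k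
mergeˢ i s = state (mergeCount i (count s)) (hasEdge? s)

module _ {n k} {i : Fin k} {H : LabelledGraph k} {φ : LabelledGraph.Vertex H → Fin n}
  {s : State n k} (d : Describes H φ s) where

  open LabelledGraph H
  open Describes d

  -- `Mergeable` is exactly the condition for `φ` to respect the coarser equality; this direction
  -- serves soundness, the converse completeness.
  merged-cong : Mergeable i s → ∀ {u v} → Merged i H u v → φ u ≡ φ v
  merged-cong mergeable (inj₁ e)       = φ-cong e
  merged-cong mergeable (inj₂ (p , q)) =
    mergeable _ _ (vertex⇒present (_ , refl , p)) (vertex⇒present (_ , refl , q))

  merged-cong⁻¹ : (∀ {u v} → Merged i H u v → φ u ≡ φ v) → Mergeable i s
  merged-cong⁻¹ mcong t t′ x y =
    let u , p , l = present⇒vertex x ; v , q , m = present⇒vertex y in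
    trans (sym p) (trans (mcong (inj₂ (l , m))) q)

  -- Merged vertices share a target. Hence vertices of different targets are never identified, and
  -- changing representatives keeps the targets of an edge, so the crossing edges stay the same.
  describes-merge : Mergeable i s → Describes (merge i H) φ (mergeˢ i s)
  describes-merge mergeable = describes-state (merge i H) φ _ mcong merged
    λ t t′ → mk⇔ to from ⇔-∘ edges t t′
    where
    mcong : ∀ {u v} → Merged i H u v → φ u ≡ φ v
    mcong = merged-cong mergeable

    capped : ∀ {t c} → Counts vertices (At H φ t i) c →
             Counts (LabelledGraph.vertices (merge i H)) (At H φ t i) (cap c)
    capped (none h)           = none h
    capped (one v p _)        = one v p λ w q → inj₂ (proj₂ p , proj₂ q)
    capped (many v w p _ _)   = one v p λ w q → inj₂ (proj₂ p , proj₂ q)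

    kept : ∀ {t l c} → l ≢ i → Counts vertices (At H φ t l) c →
           Counts (LabelledGraph.vertices (merge i H)) (At H φ t l) c
    kept l≢i (none h)           = none h
    kept l≢i (one v p u)        = one v p λ w q → inj₁ (u w q)
    kept l≢i (many v w p q v≉w) = many v w p q
      [ v≉w , (λ (e , _) → l≢i (trans (sym (proj₂ p)) e)) ]′

    merged : ∀ t l → Counts (LabelledGraph.vertices (merge i H)) (At (merge i H) φ t l)
                       (mergeCount i (count s) t l)
    merged t l with l ≟ i
    ... | yes refl = capped (counts t l)
    ... | no l≢i   = kept l≢i (counts t l)

    to : ∀ {t t′} → Crossing H φ t t′ → Crossing (merge i H) φ t t′
    to (t≢t′ , u , v , p , q , a) = t≢t′ , u , v , p , q ,
      (λ m → t≢t′ (trans (sym p) (trans (mcong m) q))) , u , v , inj₁ ≈-refl , inj₁ ≈-refl , a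

    from : ∀ {t t′} → Crossing (merge i H) φ t t′ → Crossing H φ t t′
    from (t≢t′ , u , v , p , q , _ , u′ , v′ , m , m′ , a) =
      t≢t′ , u′ , v′ , trans (sym (mcong m)) p , trans (sym (mcong m′)) q , a

-- Saturation

module _ {A : Set} {D : List A → A → Set} (D? : ∀ S → Decidable (D S))
  {Q : A → Set} (sound : ∀ {S x} → All Q S → D S x → Q x) where

  private
    -- `S` holds what has been found and `R` what is left. Each round moves a derivable element from
    -- `R` to `S`, which shortens `R`; once `R` has none, `S` is closed.
    saturate : ∀ S R → Acc _<_ (length R) → All Q S → (∀ x → x ∈ S ⊎ x ∈ R) →
      ∃ λ S′ → All Q S′ × (∀ {x} → D S′ x → x ∈ S′)
    saturate S R (acc rec) q covered with Any.any? (D? S) R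
    ... | no ¬any =
      S , q , λ {x} d → [ id , (λ x∈R → contradiction (lose x∈R d) ¬any) ]′ (covered x)
    ... | yes any with find any
    ... | x , x∈R , d with ∈-∃++ x∈R
    ... | ys , zs , refl = saturate (x ∷ S) (ys ++ zs) (rec shorter) (sound q d ∷ q) covered′
      where
      shorter : length (ys ++ zs) < length (ys ++ x ∷ zs)
      shorter = ≤-reflexive (trans (cong suc (length-++ ys))
        (trans (sym (+-suc (length ys) (length zs))) (sym (length-++ ys))))
      covered′ : ∀ y → y ∈ x ∷ S ⊎ y ∈ ys ++ zs
      covered′ y with covered y
      ... | inj₁ y∈S = inj₁ (there y∈S)
      ... | inj₂ y∈R with ∈-++⁻ ys y∈R
      ... | inj₁ y∈ys         = inj₂ (∈-++⁺ˡ y∈ys)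
      ... | inj₂ (here y≡x)   = inj₁ (here y≡x)
      ... | inj₂ (there y∈zs) = inj₂ (∈-++⁺ʳ ys y∈zs)

  saturation : ∀ universe → (∀ x → x ∈ universe) →
    ∃ λ S → All Q S × (∀ {x} → D S x → x ∈ S)
  saturation universe complete = saturate [] universe (<-wellFounded _) [] (inj₂ ∘ complete)

-- The atom i⟨m⟩ is built from m copies of i⟨1⟩, so finitely many atoms suffice.
Derivable : List (State n k) → State n k → Set
Derivable S x =
    (∃₂ λ t i → x ≡ singletonˢ t i)
  ⊎ (∃₂ λ i j → i ≢ j × Any (λ s → x ≡ joinˢ i j s) S)
  ⊎ (∃₂ λ i j → Any (λ s → x ≡ relabelˢ i j s) S)
  ⊎ (∃ λ i → Any (λ s → Mergeable i s × x ≡ mergeˢ i s) S)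
  ⊎ Any (λ s → Any (λ s′ → x ≡ unionˢ s s′) S) S

derivable? : (S : List (State n k)) → Decidable (Derivable S)
derivable? S x =
        (any? λ t → any? λ i → x ≟ˢ singletonˢ t i)
  ⊎-dec (any? λ i → any? λ j → ¬? (i ≟ j) ×-dec Any.any? (λ s → x ≟ˢ joinˢ i j s) S)
  ⊎-dec (any? λ i → any? λ j → Any.any? (λ s → x ≟ˢ relabelˢ i j s) S)
  ⊎-dec (any? λ i → Any.any? (λ s → mergeable? i s ×-dec x ≟ˢ mergeˢ i s) S)
  ⊎-dec Any.any? (λ s → Any.any? (λ s′ → x ≟ˢ unionˢ s s′) S) S

-- Soundness and completeness of the derivable states

Realised : State n k → Set
Realised {n} {k} s = Σ[ e ∈ FusionExpr k ] ∃ λ φ → Describes {n} ⟦ e ⟧ᶠ φ s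

derivable⇒realised : ∀ {S : List (State n k)} {x} → All Realised S → Derivable S x → Realised x
derivable⇒realised r (inj₁ (t , i , refl)) = i ⟨ 1 ⟩ , const t , describes-singleton i (const t)
derivable⇒realised r (inj₂ (inj₁ (i , j , i≢j , any))) with find any
... | s , s∈S , refl =
  let e , φ , d = All.lookup r s∈S in η i j i≢j e , φ , describes-join i≢j d
derivable⇒realised r (inj₂ (inj₂ (inj₁ (i , j , any)))) with find any
... | s , s∈S , refl =
  let e , φ , d = All.lookup r s∈S in ρ i j e , φ , describes-relabel d
derivable⇒realised r (inj₂ (inj₂ (inj₂ (inj₁ (i , any))))) with find any
... | s , s∈S , m , refl =
  let e , φ , d = All.lookup r s∈S in θ i e , φ , describes-merge d m
derivable⇒realised r (inj₂ (inj₂ (inj₂ (inj₂ any)))) with find any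
... | s , s∈S , any′ with find any′
... | s′ , s′∈S , refl =
  let e , φ , d = All.lookup r s∈S ; e′ , φ′ , d′ = All.lookup r s′∈S in
  e ⊕ e′ , [ φ , φ′ ]′ , describes-union d d′

module _ {n k} {S : List (State n k)} (closed : ∀ {x} → Derivable S x → x ∈ S) where

  union-closed : ∀ {s s′} → s ∈ S → s′ ∈ S → unionˢ s s′ ∈ S
  union-closed s∈S s′∈S = closed (inj₂ (inj₂ (inj₂ (inj₂ (lose s∈S (lose s′∈S refl))))))

  closed⇒covers-isolated : ∀ i m (φ : Fin (suc m) → Fin n) →
    Any (Describes (isolated i (suc m)) φ) S
  closed⇒covers-isolated i zero φ =
    lose (closed (inj₁ (φ 0F , i , refl))) (describes-singleton i φ)
  closed⇒covers-isolated i (suc m) φ with find (closed⇒covers-isolated i m (φ ∘ suc))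
  ... | s , s∈S , d =
    lose (union-closed (closed (inj₁ (φ 0F , i , refl))) s∈S) (describes-isolated-suc d)

  -- Induction on `e` for all target maps at once, because a target map of the whole graph restricts
  -- to the graphs of the subexpressions.
  closed⇒covers : (e : FusionExpr k) (φ : LabelledGraph.Vertex ⟦ e ⟧ᶠ → Fin n) →
    (∀ {u v} → LabelledGraph._≈_ ⟦ e ⟧ᶠ u v → φ u ≡ φ v) → Any (Describes ⟦ e ⟧ᶠ φ) S
  closed⇒covers (_⟨_⟩ i zero {{m≢0}}) φ φ-cong = contradiction refl (≢-nonZero⁻¹ 0 {{m≢0}})
  closed⇒covers (i ⟨ suc m ⟩) φ φ-cong = closed⇒covers-isolated i m φ
  closed⇒covers (η i j i≢j e) φ φ-cong with find (closed⇒covers e φ φ-cong)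
  ... | s , s∈S , d =
    lose (closed (inj₂ (inj₁ (i , j , i≢j , lose s∈S refl)))) (describes-join i≢j d)
  closed⇒covers (ρ i j e) φ φ-cong with find (closed⇒covers e φ φ-cong)
  ... | s , s∈S , d =
    lose (closed (inj₂ (inj₂ (inj₁ (i , j , lose s∈S refl))))) (describes-relabel d)
  -- A target map of the merged graph is also one of the graph before merging; that it agrees on
  -- merged vertices gives `Mergeable`.
  closed⇒covers (θ i e) φ φ-cong with find (closed⇒covers e φ (φ-cong ∘ inj₁))
  ... | s , s∈S , d =
    let m = merged-cong⁻¹ d φ-cong in
    lose (closed (inj₂ (inj₂ (inj₂ (inj₁ (i , lose s∈S (m , refl))))))) (describes-merge d m)
  closed⇒covers (e ⊕ e′) φ φ-cong
    with find (closed⇒covers e (φ ∘ inj₁) (φ-cong ∘ inj₁))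
       | find (closed⇒covers e′ (φ ∘ inj₂) (φ-cong ∘ inj₂))
  ... | s , s∈S , d | s′ , s′∈S , d′ = lose (union-closed s∈S s′∈S) (describes-union d d′)

closedStates : ∀ n k →
  ∃ λ (S : List (State n k)) → All Realised S × (∀ {x} → Derivable S x → x ∈ S)
closedStates n k = saturation derivable? derivable⇒realised (states n k) ∈-states

-- Deciding whether a finite graph has a fusion-tree expression

module _ {n} (G : Graph) (fin : Inverse (setoid (Fin n)) (Graph.vertices G)) where

  private
    module G = Graph G
    module fin = Inverse fin

    adj-resp : ∀ {u u′ v v′} → u G.≈ u′ → v G.≈ v′ → G.Adj u v → G.Adj u′ v′
    adj-resp p q = proj₂ G.Adj-resp p ∘ proj₁ G.Adj-resp q

  TargetAdj : Fin n → Fin n → Set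
  TargetAdj t t′ = G.Adj (fin.to t) (fin.to t′)

  -- Each target has exactly one vertex, so the target map is a bijection onto the vertices of `G`,
  -- and the edges are those of `G`.
  Final : State n k → Set
  Final s = (∀ t → ∃ λ l → count s t l ≡ 1F × (∀ l′ → l′ ≢ l → count s t l′ ≡ 0F))
          × (∀ t t′ → (HasEdge s t t′ → TargetAdj t t′) × (TargetAdj t t′ → HasEdge s t t′))

  final? : (∀ t t′ → Dec (TargetAdj t t′)) → Decidable (Final {k})
  final? adj? s =
    (all? λ t → any? λ l → count s t l ≟ 1F ×-dec
      all? λ l′ → ¬? (l′ ≟ l) →-dec count s t l′ ≟ 0F)
    ×-dec all? λ t → all? λ t′ →
      (hasEdge? s t t′ →-dec adj? t t′) ×-dec (adj? t t′ →-dec hasEdge? s t t′)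

  module _ {k} (H : LabelledGraph k) where

    open LabelledGraph H

    -- Within a fibre of `φ` one label occurs, and only once, so the fibre is a single vertex up to
    -- `≈` and `φ` is invertible.
    final⇒generates : ∀ {φ s} → Describes H φ s → Final s → graph ≅ G
    final⇒generates {φ} {s} d (fibres , edge⇔) = record
      { bijection = inverse φ-inverse fin
      ; Adj⇔      = λ u v → mk⇔ to from
      }
      where
      open Describes d
      fibre : ∀ t → ∃ λ v → φ v ≡ t × (∀ w → φ w ≡ t → v ≈ w)
      fibre t with fibres t
      ... | l , c≡1 , rest with 1⇒unique (counts t l) c≡1
      ... | v , (p , _) , unique = v , p , λ w q → unique w (q , label≡ w q)
        where
        label≡ : ∀ w → φ w ≡ t → label w ≡ l
        label≡ w q with label w ≟ l
        ... | yes e = e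
        ... | no l′≢l = contradiction (q , refl) (0⇒empty (counts t (label w)) (rest _ l′≢l) w)

      φ-injective : ∀ {u v} → φ u ≡ φ v → u ≈ v
      φ-injective {u} {v} e =
        let _ , _ , unique = fibre (φ v) in ≈-trans (≈-sym (unique u e)) (unique v refl)

      φ-inverse : Inverse vertices (setoid (Fin n))
      φ-inverse = record
        { to        = φ
        ; from      = proj₁ ∘ fibre
        ; to-cong   = φ-cong
        ; from-cong = λ { refl → ≈-refl }
        ; inverse   = (λ {t} e → trans (φ-cong e) (proj₁ (proj₂ (fibre t))))
                    , (λ {u} {t} e → proj₂ (proj₂ (fibre t)) u (sym e))
        }

      to : ∀ {u v} → Adj u v → TargetAdj (φ u) (φ v)
      -- Every edge is crossing, since by injectivity an edge inside a fibre would be a loop.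
      to {u} {v} a = proj₁ (edge⇔ _ _) (Equivalence.from (edges _ _)
        ((λ e → Adj-irrefl (φ-injective e) a) , u , v , refl , refl , a))

      from : ∀ {u v} → TargetAdj (φ u) (φ v) → Adj u v
      from a =
        let _ , _ , _ , p , q , b = Equivalence.to (edges _ _) (proj₂ (edge⇔ _ _) a) in
        proj₂ Adj-resp (φ-injective p) (proj₁ Adj-resp (φ-injective q) b)

    module _ (iso : graph ≅ G) where

      private
        module iso = _≅_ iso
        module ψ = Inverse (inverse iso.bijection (inverse-sym fin))

      target : Vertex → Fin n
      target = ψ.to

      target-cong : ∀ {u v} → u ≈ v → target u ≡ target v
      target-cong = ψ.to-cong

      -- Stated apart from `generates⇒final` because it also decides adjacency in `G`. Adjacent
      -- targets are distinct since `G` has no loops.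
      generates⇒edges : ∀ {s} → Describes H target s →
        ∀ t t′ → HasEdge s t t′ ⇔ TargetAdj t t′
      generates⇒edges d t t′ = mk⇔ to from ⇔-∘ Describes.edges d t t′
        where
        to : Crossing H target t t′ → TargetAdj t t′
        to (_ , u , v , p , q , a) = adj-resp (G.≈-sym (fin.inverseˡ (sym p)))
          (G.≈-sym (fin.inverseˡ (sym q))) (Equivalence.to (iso.Adj⇔ u v) a)
        from : TargetAdj t t′ → Crossing H target t t′
        from a = (λ e → G.Adj-irrefl (fin.to-cong e) a)
          , ψ.from t , ψ.from t′ , ψ.strictlyInverseˡ t , ψ.strictlyInverseˡ t′
          , Equivalence.from (iso.Adj⇔ _ _) (adj-resp (toFrom t) (toFrom t′) a)
          where
          toFrom : ∀ t → fin.to t G.≈ iso.to (ψ.from t)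
          toFrom t = G.≈-sym (Inverse.strictlyInverseˡ iso.bijection (fin.to t))

      generates⇒final : ∀ {s} → Describes H target s → Final s
      generates⇒final {s} d = fibres , λ t t′ →
        Equivalence.to (generates⇒edges d t t′) , Equivalence.from (generates⇒edges d t t′)
        where
        open Describes d
        fibres : ∀ t → ∃ λ l → count s t l ≡ 1F × (∀ l′ → l′ ≢ l → count s t l′ ≡ 0F)
        fibres t = label (ψ.from t)
          , unique⇒1 (counts t _) (ψ.strictlyInverseˡ t , refl) (λ w (p , _) → ψ.inverseʳ (sym p))
          , λ l′ l′≢l → empty⇒0 (counts t l′)
              (λ { w (p , refl) → l′≢l (sym (label-cong (ψ.inverseʳ (sym p)))) })

  -- Adjacency in a `Graph` is an arbitrary relation. One expression for `G` makes it decidable,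
  -- through the edges of a state that describes the generated graph; this then serves every number
  -- of labels.
  generated⇒adj? : (e : FusionExpr k) → e Generatesᶠ G → ∀ t t′ → Dec (TargetAdj t t′)
  generated⇒adj? {k} e iso t t′ =
    let _ , _ , closed = closedStates n k
        s , _ , d = find (closed⇒covers closed e (target ⟦ e ⟧ᶠ iso) (target-cong ⟦ e ⟧ᶠ iso))
        adj = generates⇒edges ⟦ e ⟧ᶠ iso d t t′
    in map′ (Equivalence.to adj) (Equivalence.from adj) (hasEdge? s t t′)

  -- A closed list has a `Final` state exactly when `G` is generated: its states are realised by
  -- expressions, and it covers every expression with the targets given by the isomorphism.
  generated? : (∀ t t′ → Dec (TargetAdj t t′)) →
    Decidable (λ k → Σ[ e ∈ FusionExpr k ] e Generatesᶠ G)
  generated? adj? k with closedStates n k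
  ... | S , realised , closed = map′ to from (Any.any? (final? adj?) S)
    where
    to : Any Final S → Σ[ e ∈ FusionExpr k ] e Generatesᶠ G
    to any =
      let s , s∈S , final = find any
          e , φ , d = All.lookup realised s∈S
      in e , final⇒generates ⟦ e ⟧ᶠ d final
    from : Σ[ e ∈ FusionExpr k ] e Generatesᶠ G → Any Final S
    from (e , iso) = Any.map (generates⇒final ⟦ e ⟧ᶠ iso)
      (closed⇒covers closed e (target ⟦ e ⟧ᶠ iso) (target-cong ⟦ e ⟧ᶠ iso))

-- Least numbers with a decidable property

least : ∀ {P : ℕ → Set} → Decidable P → ∀ k → P k → ∃[ f ] (IsLeast P f × f ≤ k)
least {P} P? = <-rec _ λ k rec Pk → go k rec Pk (anyUpTo? P? k)
  where
  go : ∀ k → (∀ {j} → j < k → P j → ∃[ f ] (IsLeast P f × f ≤ j)) → P k →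
    Dec (∃ λ j → j < k × P j) → ∃[ f ] (IsLeast P f × f ≤ k)
  go k rec Pk (yes (j , j<k , Pj)) =
    let f , isLeast , f≤j = rec j<k Pj in f , isLeast , ≤-trans f≤j (<⇒≤ j<k)
  go k rec Pk (no ¬smaller) =
    k , (Pk , λ j Pj → ≮⇒≥ λ j<k → ¬smaller (j , j<k , Pj)) , ≤-refl

-- Reading a k-expression as a fusion-tree expression

fuse : Expr k → FusionExpr k
fuse (atom i)      = i ⟨ 1 ⟩
fuse (η i j i≢j e) = η i j i≢j (fuse e)
fuse (ρ i j e)     = ρ i j (fuse e)
fuse (d ⊕ e)       = fuse d ⊕ fuse e

-- An equality rather than an isomorphism, since both semantics use the same graph constructions.
⟦fuse⟧ : (e : Expr k) → ⟦ fuse e ⟧ᶠ ≡ ⟦ e ⟧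
⟦fuse⟧ (atom i)      = refl
⟦fuse⟧ (η i j i≢j e) = cong (join i j i≢j) (⟦fuse⟧ e)
⟦fuse⟧ (ρ i j e)     = cong (relabel i j) (⟦fuse⟧ e)
⟦fuse⟧ (d ⊕ e)       = cong₂ disjointUnion (⟦fuse⟧ d) (⟦fuse⟧ e)

operations-fuse : (e : Expr k) → operationsᶠ (fuse e) ≡ operations e
operations-fuse (atom i)      = refl
operations-fuse (η _ _ _ e)   = cong suc (operations-fuse e)
operations-fuse (ρ _ _ e)     = cong suc (operations-fuse e)
operations-fuse (d ⊕ e)       = cong₂ (λ a b → suc (a + b)) (operations-fuse d) (operations-fuse e)

fuse-generates : ∀ {G} (e : Expr k) → e Generates G → fuse e Generatesᶠ G
fuse-generates {G = G} e = subst (λ H → LabelledGraph.graph H ≅ G) (sym (⟦fuse⟧ e))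

theorem1 : (k : ℕ) .{{_ : NonZero k}} (G : Graph) → Finite G → Nonempty G →
    (IsCliqueWidth G k → ∃[ f ] (IsFusionWidth G f × f ≤ k))
    × ((e : Expr k) → e Generates G →
        Σ[ e′ ∈ FusionExpr k ] (e′ Generatesᶠ G × operationsᶠ e′ ≤ operations e))
theorem1 k G (_ , fin) _ =
    (λ ((e , gen) , _) →
      -- The translated expression is used twice: to decide adjacency in `G`, and as the witness at
      -- `k` from which the search descends.
      let e′ = fuse e ; gen′ = fuse-generates e gen
      in least (generated? G fin (generated⇒adj? G fin e′ gen′)) k (e′ , gen′))
  , (λ e gen → fuse e , fuse-generates e gen , ≤-reflexive (operations-fuse e))
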